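{- For every $K_3N$ $n=pqr$, $q<\sqrt{\dfrac np}-\sqrt{\dfrac p{12}}$.
   Context: A $K_3N$ (Korselt number with three factors) is an integer $n$ together with a factorisation $n=pqr$, where $1<p<q<r$ are odd integers (not necessarily prime) such that each of $p-1,\ q-1,\ r-1$ divides $n-1$, and such that $E:=\dfrac{pq-1}{r-1}$ (which is an integer by the divisibility condition) satisfies $E\ge 2$. -}

module Defs where

open import Data.Nat as ℕ using (ℕ; zero; suc)
import Data.Nat.Properties as ℕ
open import Data.Nat.Divisibility using (_∣_; _∤_; quotient; ∣m+n∣m⇒∣n; n∣m*n)
open import Data.Integer as ℤ using (+_; -[1+_])
import Data.Integer.Properties as ℤ
open import Data.Rational
open import Data.Rational.Properties
import Data.Rational.Unnormalised as ℚᵘ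
import Data.Rational.Unnormalised.Properties as ℚᵘ
open import Data.Rational.Solver using (module +-*-Solver)
open import Data.Empty using (⊥)
open import Data.Product using (∃; ∃₂; _×_; _,_)
open import Data.Sum using (_⊎_; inj₁; inj₂)
open import Relation.Nullary using (yes; no; contradiction)
open import Relation.Binary.PropositionalEquality

open +-*-Solver using (solve; _:+_; _:*_; _:-_; _:=_; con)

Odd : ℕ → Set
Odd m = 2 ∤ m

r-1∣mr-1⇒r-1∣m-1 : ∀ m r → 1 ℕ.≤ m → 1 ℕ.≤ r →
                   r ℕ.∸ 1 ∣ m ℕ.* r ℕ.∸ 1 → r ℕ.∸ 1 ∣ m ℕ.∸ 1
r-1∣mr-1⇒r-1∣m-1 m (suc r) 1≤m _ h = ∣m+n∣m⇒∣n (subst (r ∣_) eq h) (n∣m*n m)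
  where
  open ≡-Reasoning
  eq : m ℕ.* suc r ℕ.∸ 1 ≡ m ℕ.* r ℕ.+ (m ℕ.∸ 1)
  eq = begin
    m ℕ.* suc r ℕ.∸ 1         ≡⟨ cong (ℕ._∸ 1) (ℕ.*-suc m r) ⟩
    m ℕ.+ m ℕ.* r ℕ.∸ 1       ≡⟨ cong (ℕ._∸ 1) (ℕ.+-comm m (m ℕ.* r)) ⟩
    m ℕ.* r ℕ.+ m ℕ.∸ 1       ≡⟨ ℕ.+-∸-assoc (m ℕ.* r) 1≤m ⟩
    m ℕ.* r ℕ.+ (m ℕ.∸ 1)     ∎

-- All factors exceed 1, so natural numbers with truncated subtraction lose
-- nothing compared with integers.
record K₃N : Set where
  field
    n p q r : ℕ
    n≡pqr   : n ≡ p ℕ.* q ℕ.* r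
    1<p     : 1 ℕ.< p
    p<q     : p ℕ.< q
    q<r     : q ℕ.< r
    p-odd   : Odd p
    q-odd   : Odd q
    r-odd   : Odd r
    p-1∣n-1 : p ℕ.∸ 1 ∣ n ℕ.∸ 1
    q-1∣n-1 : q ℕ.∸ 1 ∣ n ℕ.∸ 1
    r-1∣n-1 : r ℕ.∸ 1 ∣ n ℕ.∸ 1

  0<p : 0 ℕ.< p
  0<p = ℕ.<-trans ℕ.z<s 1<p
  0<q : 0 ℕ.< q
  0<q = ℕ.<-trans 0<p p<q
  0<r : 0 ℕ.< r
  0<r = ℕ.<-trans 0<q q<r

  r-1∣pq-1 : r ℕ.∸ 1 ∣ p ℕ.* q ℕ.∸ 1
  r-1∣pq-1 = r-1∣mr-1⇒r-1∣m-1 (p ℕ.* q) r (ℕ.*-mono-≤ 0<p 0<q) 0<r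
               (subst (λ x → r ℕ.∸ 1 ∣ x ℕ.∸ 1) n≡pqr r-1∣n-1)

  -- E * (r - 1) = p q - 1 and r - 1 > 0, so E is exactly (p q - 1) / (r - 1).
  E : ℕ
  E = quotient r-1∣pq-1

  field
    2≤E : 2 ℕ.≤ E

  instance
    p≢0 : ℕ.NonZero p
    p≢0 = ℕ.>-nonZero 0<p

x<y⇒0<y-x : ∀ {x y} → x < y → 0ℚ < y - x
x<y⇒0<y-x {x} {y} x<y = subst (_< y - x) (+-inverseʳ x) (+-monoˡ-< (- x) x<y)

0<y-x⇒x<y : ∀ {x y} → 0ℚ < y - x → x < y
0<y-x⇒x<y {x} {y} h =
  subst₂ _<_ (+-identityʳ x) (solve 2 (λ x y → x :+ (y :- x) := y) refl x y) (+-monoʳ-< x h)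

0<x*y : ∀ {x y} → 0ℚ < x → 0ℚ < y → 0ℚ < x * y
0<x*y {x} {y} 0<x 0<y =
  subst (_< x * y) (*-zeroʳ x) (*-monoʳ-<-pos x {{positive 0<x}} 0<y)

x<x+y : ∀ x {y} → 0ℚ < y → x < x + y
x<x+y x {y} 0<y = subst (_< x + y) (+-identityʳ x) (+-monoʳ-< x 0<y)

inverse : ∀ {x} → 0ℚ < x → ∃ λ i → 0ℚ < i × i * x ≡ 1ℚ
inverse {x} 0<x = (1/ x) , positive⁻¹ (1/ x) {{1/pos⇒pos x}} , *-inverseˡ x
  where
  instance
    x>0 : Positive x
    x>0 = positive 0<x
    x≢0 : NonZero x
    x≢0 = pos⇒nonZero x

square-mono-< : ∀ {s t} → 0ℚ ≤ s → s < t → s * s < t * t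
square-mono-< {s} {t} 0≤s s<t = ≤-<-trans
  (*-monoˡ-≤-nonNeg s {{nonNegative 0≤s}} (<⇒≤ s<t))
  (*-monoˡ-<-pos t {{positive (≤-<-trans 0≤s s<t)}} s<t)

fromℕℚ : ℕ → ℚ
fromℕℚ zero    = 0ℚ
fromℕℚ (suc k) = 1ℚ + fromℕℚ k

toℚᵘ-fromℕℚ : ∀ k → toℚᵘ (fromℕℚ k) ℚᵘ.≃ ℚᵘ.mkℚᵘ (+ k) 0
toℚᵘ-fromℕℚ zero    = ℚᵘ.≃-refl
toℚᵘ-fromℕℚ (suc k) = ℚᵘ.≃-trans (toℚᵘ-homo-+ 1ℚ (fromℕℚ k))
  (ℚᵘ.≃-trans (ℚᵘ.+-congʳ (toℚᵘ 1ℚ) (toℚᵘ-fromℕℚ k))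
    (ℚᵘ.*≡* (cong (λ x → (+ 1 ℤ.+ x) ℤ.* + 1) (ℤ.*-identityʳ (+ k)))))

x≤fromℕℚ : ∀ x → x ≤ fromℕℚ ℤ.∣ ↥ x ∣
x≤fromℕℚ x = toℚᵘ-cancel-≤ (ℚᵘ.≤-respʳ-≃ (ℚᵘ.≃-sym (toℚᵘ-fromℕℚ ℤ.∣ ↥ x ∣)) (aux x))
  where
  aux : ∀ x → toℚᵘ x ℚᵘ.≤ ℚᵘ.mkℚᵘ (+ ℤ.∣ ↥ x ∣) 0
  aux (mkℚ (+ m) d _) = ℚᵘ.*≤* (subst₂ ℤ._≤_ (sym (ℤ.*-identityʳ (+ m))) (ℤ.pos-* m (suc d))
                                 (ℤ.+≤+ (ℕ.m≤m*n m (suc d))))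
  aux (mkℚ -[1+ m ] d _) = ℚᵘ.*≤* ℤ.-≤+

archimedean : ∀ x {δ} → 0ℚ < δ → ∃ λ k → x ≤ fromℕℚ k * δ
archimedean x {δ} 0<δ with inverse 0<δ
... | i , _ , iδ≡1 = ℤ.∣ ↥ (x * i) ∣ , (begin
  x                              ≡⟨ *-identityʳ x ⟨
  x * 1ℚ                         ≡⟨ cong (x *_) iδ≡1 ⟨
  x * (i * δ)                    ≡⟨ *-assoc x i δ ⟨
  x * i * δ                      ≤⟨ *-monoʳ-≤-nonNeg δ {{nonNegative (<⇒≤ 0<δ)}} (x≤fromℕℚ (x * i)) ⟩
  fromℕℚ ℤ.∣ ↥ (x * i) ∣ * δ     ∎)
  where open ≤-Reasoning

record ℝ : Set₁ where
  field
    Lower Upper     : ℚ → Set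
    lower-inhabited : ∃ Lower
    upper-inhabited : ∃ Upper
    lower-closed    : ∀ {s t} → s < t → Lower t → Lower s
    upper-closed    : ∀ {s t} → s < t → Upper s → Upper t
    lower-open      : ∀ {s} → Lower s → ∃ λ t → s < t × Lower t
    upper-open      : ∀ {t} → Upper t → ∃ λ s → s < t × Upper s
    disjoint        : ∀ {s} → Lower s → Upper s → ⊥
    located         : ∀ {s t} → s < t → Lower s ⊎ Upper t

open ℝ

infix 4 _<ᵣ_

_<ᵣ_ : ℝ → ℝ → Set
x <ᵣ y = ∃ λ s → Upper x s × Lower y s

lower<upper : ∀ x {s t} → Lower x s → Upper x t → s < t
lower<upper x {s} {t} s∈L t∈U with s <? t
... | yes s<t = s<t
... | no  s≮t with lower-open x s∈L
...   | s′ , s<s′ , s′∈L = contradiction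
        (upper-closed x (≤-<-trans (≮⇒≥ s≮t) s<s′) t∈U) (disjoint x s′∈L)

fromℚ : ℚ → ℝ
fromℚ a = record
  { Lower           = _< a
  ; Upper           = a <_
  ; lower-inhabited = a - 1ℚ , subst (a - 1ℚ <_) (+-identityʳ a) (+-monoʳ-< a (negative⁻¹ (- 1ℚ)))
  ; upper-inhabited = a + 1ℚ , x<x+y a (positive⁻¹ 1ℚ)
  ; lower-closed    = <-trans
  ; upper-closed    = λ s<t a<s → <-trans a<s s<t
  ; lower-open      = <-dense
  ; upper-open      = λ a<t → let m , a<m , m<t = <-dense a<t in m , m<t , a<m
  ; disjoint        = <-asym
  ; located         = loc
  }
  where
  loc : ∀ {s t} → s < t → s < a ⊎ a < t
  loc {s} s<t with s <? a
  ... | yes s<a = inj₁ s<a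
  ... | no  s≮a = inj₂ (≤-<-trans (≮⇒≥ s≮a) s<t)

fromℕ : ℕ → ℝ
fromℕ m = fromℚ (+ m / 1)

approximate : ∀ x {δ} → 0ℚ < δ → ∃₂ λ l u → Lower x l × Upper x u × u ≤ l + (δ + δ)
approximate x {δ} 0<δ with lower-inhabited x | upper-inhabited x
... | l₀ , l₀∈L | u₀ , u₀∈U with archimedean (u₀ - l₀) 0<δ
...   | k , u₀-l₀≤kδ = search k l₀∈L
          (subst (_≤ l₀ + fromℕℚ k * δ) (solve 2 (λ l u → l :+ (u :- l) := u) refl l₀ u₀)
            (+-monoʳ-≤ l₀ u₀-l₀≤kδ))
  where
  search : ∀ k {l} → Lower x l → u₀ ≤ l + fromℕℚ k * δ →
           ∃₂ λ l u → Lower x l × Upper x u × u ≤ l + (δ + δ)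
  search zero {l} l∈L u₀≤l = contradiction
    (<-≤-trans (lower<upper x l∈L u₀∈U) (subst (u₀ ≤_) (solve 2 (λ l d → l :+ con 0ℚ :* d := l) refl l δ) u₀≤l))
    (<-irrefl refl)
  search (suc k) {l} l∈L h with located x (+-monoʳ-< l (x<x+y δ 0<δ))
  ... | inj₂ u∈U   = l , l + (δ + δ) , l∈L , u∈U , ≤-refl
  ... | inj₁ l+δ∈L = search k l+δ∈L (subst (u₀ ≤_)
        (solve 3 (λ l d k → l :+ (con 1ℚ :+ k) :* d := l :+ d :+ k :* d) refl l δ (fromℕℚ k)) h)

half : ∀ x → ½ * x + ½ * x ≡ x
half x = trans (sym (*-distribʳ-+ x ½ ½)) (*-identityˡ x)

eighth : ∀ {s t} → s < t → ∃ λ δ → 0ℚ < δ × s + (δ + δ + (δ + δ)) < t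
eighth {s} {t} s<t = δ , 0<½* (0<½* 0<½d) ,
  subst₂ _<_ (cong (λ x → s + x) (sym 4δ≡½d)) s+½d+½d≡t (+-monoʳ-< s (x<x+y (½ * d) 0<½d))
  where
  d = t - s
  δ = ½ * (½ * (½ * d))
  0<½* : ∀ {x} → 0ℚ < x → 0ℚ < ½ * x
  0<½* = 0<x*y (positive⁻¹ ½)
  0<½d : 0ℚ < ½ * d
  0<½d = 0<½* (x<y⇒0<y-x s<t)
  4δ≡½d : δ + δ + (δ + δ) ≡ ½ * d
  4δ≡½d = trans (cong₂ _+_ (half (½ * (½ * d))) (half (½ * (½ * d)))) (half (½ * d))
  s+½d+½d≡t : s + (½ * d + ½ * d) ≡ t
  s+½d+½d≡t = trans (cong (λ x → s + x) (half d)) (solve 2 (λ s t → s :+ (t :- s) := t) refl s t)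

infixl 6 _-ᵣ_

_-ᵣ_ : ℝ → ℝ → ℝ
x -ᵣ y = record
  { Lower           = L
  ; Upper           = U
  ; lower-inhabited = let a , a∈ = lower-inhabited x ; b , b∈ = upper-inhabited y
                          s , s< = lower-inhabited (fromℚ (a - b))
                      in s , a , b , a∈ , b∈ , s<
  ; upper-inhabited = let a , a∈ = upper-inhabited x ; b , b∈ = lower-inhabited y
                      in (a - b) + 1ℚ , a , b , a∈ , b∈ , x<x+y (a - b) (positive⁻¹ 1ℚ)
  ; lower-closed    = λ { s<t (a , b , a∈ , b∈ , t<) → a , b , a∈ , b∈ , <-trans s<t t< }
  ; upper-closed    = λ { s<t (a , b , a∈ , b∈ , <s) → a , b , a∈ , b∈ , <-trans <s s<t }
  ; lower-open      = λ { (a , b , a∈ , b∈ , s<) →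
                          let m , s<m , m< = <-dense s< in m , s<m , a , b , a∈ , b∈ , m< }
  ; upper-open      = λ { (a , b , a∈ , b∈ , <t) →
                          let m , <m , m<t = <-dense <t in m , m<t , a , b , a∈ , b∈ , <m }
  ; disjoint        = λ { (a , b , a∈ , b∈ , s<) (a′ , b′ , a′∈ , b′∈ , <s) →
                          <-asym (<-trans <s s<)
                            (+-mono-< (lower<upper x a∈ a′∈) (neg-antimono-< (lower<upper y b′∈ b∈))) }
  ; located         = loc
  }
  where
  L U : ℚ → Set
  L s = ∃₂ λ a b → Lower x a × Upper y b × s < a - b
  U t = ∃₂ λ a b → Upper x a × Lower y b × a - b < t

  -- Approximating both cuts within 2 δ gives (a′ - b) - (a - b′) ≤ 4 δ < t - s,
  -- so s < a - b′ or a′ - b < t according to the position of a - b′.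
  loc : ∀ {s t} → s < t → L s ⊎ U t
  loc {s} {t} s<t = go (eighth s<t)
    where
    go : (∃ λ δ → 0ℚ < δ × s + (δ + δ + (δ + δ)) < t) → L s ⊎ U t
    go (δ , 0<δ , s+4δ<t) = decide (approximate x 0<δ) (approximate y 0<δ)
      where
      open ≤-Reasoning
      decide : (∃₂ λ a a′ → Lower x a × Upper x a′ × a′ ≤ a + (δ + δ)) →
               (∃₂ λ b b′ → Lower y b × Upper y b′ × b′ ≤ b + (δ + δ)) → L s ⊎ U t
      decide (a , a′ , a∈ , a′∈ , a′≤) (b , b′ , b∈ , b′∈ , b′≤) with s <? a - b′
      ... | yes s< = inj₁ (a , b′ , a∈ , b′∈ , s<)
      ... | no  s≮ = inj₂ (a′ , b , a′∈ , b∈ , (begin-strict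
        a′ - b
          ≤⟨ +-monoˡ-≤ (- b) a′≤ ⟩
        a + (δ + δ) - b
          ≡⟨ solve 3 (λ a b e → a :+ e :- b := a :+ (e :+ e) :- (b :+ e)) refl a b (δ + δ) ⟩
        a + (δ + δ + (δ + δ)) - (b + (δ + δ))
          ≤⟨ +-monoʳ-≤ (a + (δ + δ + (δ + δ))) (neg-antimono-≤ b′≤) ⟩
        a + (δ + δ + (δ + δ)) - b′
          ≡⟨ solve 3 (λ a b e → a :+ e :- b := a :- b :+ e) refl a b′ (δ + δ + (δ + δ)) ⟩
        a - b′ + (δ + δ + (δ + δ))
          ≤⟨ +-monoˡ-≤ (δ + δ + (δ + δ)) (≮⇒≥ s≮) ⟩
        s + (δ + δ + (δ + δ))
          <⟨ s+4δ<t ⟩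
        t ∎))

-- For a < 0 the formulas below define the cut of 0.
√ : ℚ → ℝ
√ a = record
  { Lower           = L
  ; Upper           = U
  ; lower-inhabited = - 1ℚ , inj₁ (negative⁻¹ (- 1ℚ))
  ; upper-inhabited = inh
  ; lower-closed    = closed
  ; upper-closed    = λ { s<t (0<s , a<s²) →
                          <-trans 0<s s<t , <-trans a<s² (square-mono-< (<⇒≤ 0<s) s<t) }
  ; lower-open      = openL
  ; upper-open      = openU
  ; disjoint        = λ { (inj₁ s<0) (0<s , _) → <-asym s<0 0<s
                        ; (inj₂ s²<a) (_ , a<s²) → <-asym s²<a a<s² }
  ; located         = loc
  }
  where
  L U : ℚ → Set
  L s = s < 0ℚ ⊎ s * s < a
  U t = 0ℚ < t × a < t * t

  inh : ∃ U
  inh with a <? 1ℚ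
  ... | yes a<1 = 1ℚ , positive⁻¹ 1ℚ , a<1
  ... | no  a≮1 = 1ℚ + a , <-trans 0<a a<1+a ,
          <-trans a<1+a (subst (_< (1ℚ + a) * (1ℚ + a)) (*-identityʳ (1ℚ + a))
            (*-monoʳ-<-pos (1ℚ + a) {{positive (<-trans 0<a a<1+a)}} (x<x+y 1ℚ 0<a)))
    where
    0<a : 0ℚ < a
    0<a = <-≤-trans (positive⁻¹ 1ℚ) (≮⇒≥ a≮1)
    a<1+a : a < 1ℚ + a
    a<1+a = subst (a <_) (+-comm a 1ℚ) (x<x+y a (positive⁻¹ 1ℚ))

  closed : ∀ {s t} → s < t → L t → L s
  closed s<t (inj₁ t<0) = inj₁ (<-trans s<t t<0)
  closed {s} s<t (inj₂ t²<a) with s <? 0ℚ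
  ... | yes s<0 = inj₁ s<0
  ... | no  s≮0 = inj₂ (<-trans (square-mono-< (≮⇒≥ s≮0) s<t) t²<a)

  loc : ∀ {s t} → s < t → L s ⊎ U t
  loc {s} s<t with s <? 0ℚ | s * s <? a
  ... | yes s<0 | _        = inj₁ (inj₁ s<0)
  ... | no  _   | yes s²<a = inj₁ (inj₂ s²<a)
  ... | no  s≮0 | no  s²≮a = inj₂ (≤-<-trans (≮⇒≥ s≮0) s<t ,
                               ≤-<-trans (≮⇒≥ s²≮a) (square-mono-< (≮⇒≥ s≮0) s<t))

  -- The increment is d / (d + 2 s + 1) with d = a - s².
  openL : ∀ {s} → L s → ∃ λ t → s < t × L t
  openL (inj₁ s<0) = let m , s<m , m<0 = <-dense s<0 in m , s<m , inj₁ m<0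
  openL {s} (inj₂ s²<a) with s <? 0ℚ
  ... | yes s<0 = let m , s<m , m<0 = <-dense s<0 in m , s<m , inj₁ m<0
  ... | no  s≮0 = go (inverse (+-mono-< 0<d 0<2s+1))
    where
    d = a - s * s
    0<d : 0ℚ < d
    0<d = x<y⇒0<y-x s²<a
    0<2s+1 : 0ℚ < s + s + 1ℚ
    0<2s+1 = +-mono-≤-< (+-mono-≤ (≮⇒≥ s≮0) (≮⇒≥ s≮0)) (positive⁻¹ 1ℚ)
    go : (∃ λ i → 0ℚ < i × i * (d + (s + s + 1ℚ)) ≡ 1ℚ) → ∃ λ t → s < t × L t
    go (i , 0<i , i*w≡1) = s + d * i , x<x+y s (0<x*y 0<d 0<i) ,
      inj₂ (0<y-x⇒x<y (subst (0ℚ <_) eq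
        (0<x*y (0<x*y 0<d 0<i) (+-mono-< 0<d (0<x*y 0<i 0<2s+1)))))
      where
      open ≡-Reasoning
      eq : d * i * (d + i * (s + s + 1ℚ)) ≡ a - (s + d * i) * (s + d * i)
      eq = begin
        d * i * (d + i * (s + s + 1ℚ))
          ≡⟨ solve 3 (λ a s i → let d = a :- s :* s
                                    w = s :+ s :+ con 1ℚ in
               d :* i :* (d :+ i :* w)
               := a :- (s :+ d :* i) :* (s :+ d :* i)
                  :+ d :* (i :* (d :+ w) :- con 1ℚ) :* (i :+ con 1ℚ)) refl a s i ⟩
        a - (s + d * i) * (s + d * i) + d * (i * (d + (s + s + 1ℚ)) - 1ℚ) * (i + 1ℚ)
          ≡⟨ cong (λ e → a - (s + d * i) * (s + d * i) + d * (e - 1ℚ) * (i + 1ℚ)) i*w≡1 ⟩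
        a - (s + d * i) * (s + d * i) + d * (1ℚ - 1ℚ) * (i + 1ℚ)
          ≡⟨ solve 3 (λ x d i → x :+ d :* (con 1ℚ :- con 1ℚ) :* (i :+ con 1ℚ) := x) refl
               (a - (s + d * i) * (s + d * i)) d i ⟩
        a - (s + d * i) * (s + d * i) ∎

  -- For a > 0 the smaller element is the Newton iterate (t + a / t) / 2.
  openU : ∀ {t} → U t → ∃ λ s → s < t × U s
  openU {t} (0<t , a<t²) with 0ℚ <? a
  ... | no  0≮a = let m , 0<m , m<t = <-dense 0<t
                  in m , m<t , 0<m , ≤-<-trans (≮⇒≥ 0≮a) (0<x*y 0<m 0<m)
  ... | yes 0<a = go (inverse 0<t)
    where
    go : (∃ λ i → 0ℚ < i × i * t ≡ 1ℚ) → ∃ λ s → s < t × U s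
    go (i , 0<i , it≡1) = s , 0<y-x⇒x<y (subst (0ℚ <_) eq₁ 0<e) ,
        0<x*y (positive⁻¹ ½) (+-mono-< 0<t (0<x*y 0<a 0<i)) ,
        0<y-x⇒x<y (subst (0ℚ <_) eq₂ (0<x*y 0<e 0<e))
      where
      open ≡-Reasoning
      s = ½ * (t + a * i)
      e = ½ * i * (t * t - a)
      0<e : 0ℚ < e
      0<e = 0<x*y (0<x*y (positive⁻¹ ½) 0<i) (x<y⇒0<y-x a<t²)
      eq₁ : e ≡ t - s
      eq₁ = begin
        ½ * i * (t * t - a)
          ≡⟨ solve 3 (λ a t i → con ½ :* i :* (t :* t :- a)
                              := con ½ :* (i :* t :* t :- a :* i)) refl a t i ⟩
        ½ * (i * t * t - a * i)
          ≡⟨ cong (λ z → ½ * (z * t - a * i)) it≡1 ⟩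
        ½ * (1ℚ * t - a * i)
          ≡⟨ solve 2 (λ t z → con ½ :* (con 1ℚ :* t :- z) := t :- con ½ :* (t :+ z)) refl t (a * i) ⟩
        t - s ∎
      eq₂ : e * e ≡ s * s - a
      eq₂ = begin
        e * e
          ≡⟨ cong (λ z → z * z) eq₁ ⟩
        (t - s) * (t - s)
          ≡⟨ solve 3 (λ a t i → let s = con ½ :* (t :+ a :* i) in
               (t :- s) :* (t :- s) := s :* s :- a :* (i :* t)) refl a t i ⟩
        s * s - a * (i * t)
          ≡⟨ cong (λ z → s * s - a * z) it≡1 ⟩
        s * s - a * 1ℚ
          ≡⟨ cong (λ z → s * s - z) (*-identityʳ a) ⟩
        s * s - a ∎

{-# OPTIONS --safe #-}
-- Put p = a + 1, q = b + 1, r = b + d + 1, E = (pq - 1) / (r - 1),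
-- F = (pr - 1) / (q - 1) and f = F - E.  Reducing b c + b + c ≡ 0 (mod a), where
-- c = b + d, with E c ≡ b and F b ≡ c (mod a) gives a ∣ d (d + f).  Since
-- f b = (E + p) d and E < p < q, we have f < 2 d, hence a + d ≤ 3 d².  This leaves
-- room for a rational w > √ (p / 12) with (q + w)² < q r = n / p.
module Submission where

open import Defs using (K₃N; fromℕ; fromℚ; √; _-ᵣ_; _<ᵣ_; ℝ; r-1∣mr-1⇒r-1∣m-1)
open import Data.Nat hiding (_/_)
open import Data.Nat.Properties
open import Data.Nat.Divisibility using (_∣_; divides; ∣m+n∣m⇒∣n; m∣m*n; ∣⇒≤)
open import Data.Nat.Tactic.RingSolver using (solve-∀)
open import Data.Integer as ℤ using (+_)
import Data.Integer.Properties as ℤ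
open import Data.Rational as ℚ using (0ℚ; _/_; toℚᵘ)
import Data.Rational.Properties as ℚ
open import Data.Rational.Unnormalised as ℚᵘ using (mkℚᵘ)
import Data.Rational.Unnormalised.Properties as ℚᵘ
open import Data.Product using (∃₂; _×_; _,_)
open import Data.Sum using (inj₂)
open import Relation.Nullary using (contradiction)
open import Relation.Binary.PropositionalEquality

-- Congruences modulo `p - 1`.

-- Write c = b + d and F = E + f. Modulo `a`, `hG` says (b + 1)(c + 1) ≡ 1, so E c ≡ b times b + 1
-- gives E b ≡ - b (b + 1), and likewise F c ≡ - c (c + 1). Expanding (c - b)² + (c - b)(F - E) then
-- leaves - 2 (b c + b + c) ≡ 0.
a∣d*[d+f] : ∀ a b d E f G →
  E * (b + d) ≡ b + a * suc b →
  (E + f) * b ≡ b + d + a * suc (b + d) →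
  G * a ≡ b + d + b * suc (b + d) →
  a ∣ d * (d + f)
a∣d*[d+f] a b d E f G hE hF hG =
  ∣m+n∣m⇒∣n (divides (G * (E + (E + f))) (+-cancelʳ-≡ _ _ _ combination)) (m∣m*n s)
  where
  open ≡-Reasoning
  c = b + d
  s = suc b * (2 + b) + suc c * (2 + c) + 2 * G
  l = a * s + d * (d + f)
  r = G * (E + (E + f)) * a
  -- The three hypotheses enter with the multipliers 2 + b, 2 + c and E + (E + f) - 2;
  -- negative terms are moved to the other side.
  weighted : ℕ → ℕ → ℕ → ℕ → ℕ
  weighted x y z w = (2 + b) * x + (2 + c) * y + ((E + (E + f)) * z + 2 * w)
  identity : ∀ a b d E f G →
    a * (suc b * (2 + b) + suc (b + d) * (2 + (b + d)) + 2 * G) + d * (d + f)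
      + ((2 + b) * (E * (b + d)) + (2 + (b + d)) * ((E + f) * b)
          + ((E + (E + f)) * (G * a) + 2 * (b + d + b * suc (b + d))))
    ≡ G * (E + (E + f)) * a
      + ((2 + b) * (b + a * suc b) + (2 + (b + d)) * (b + d + a * suc (b + d))
          + ((E + (E + f)) * (b + d + b * suc (b + d)) + 2 * (G * a)))
  identity = solve-∀
  combination : l + weighted (E * c) ((E + f) * b) (G * a) (G * a)
              ≡ r + weighted (E * c) ((E + f) * b) (G * a) (G * a)
  combination = begin
    l + weighted (E * c) ((E + f) * b) (G * a) (G * a)
      ≡⟨ cong (λ x → l + weighted (E * c) ((E + f) * b) (G * a) x) hG ⟩
    l + weighted (E * c) ((E + f) * b) (G * a) (c + b * suc c)
      ≡⟨ identity a b d E f G ⟩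
    r + weighted (b + a * suc b) (c + a * suc c) (c + b * suc c) (G * a)
      ≡⟨ cong₂ (λ x y → r + weighted x y (c + b * suc c) (G * a)) hE hF ⟨
    r + weighted (E * c) ((E + f) * b) (c + b * suc c) (G * a)
      ≡⟨ cong (λ x → r + weighted (E * c) ((E + f) * b) x (G * a)) hG ⟨
    r + weighted (E * c) ((E + f) * b) (G * a) (G * a) ∎

f*b≡[E+p]*d : ∀ a b d E f →
  E * (b + d) ≡ b + a * suc b →
  (E + f) * b ≡ b + d + a * suc (b + d) →
  f * b ≡ (E + suc a) * d
f*b≡[E+p]*d a b d E f hE hF = +-cancelˡ-≡ (E * b) _ _ (begin
  E * b + f * b                ≡⟨ *-distribʳ-+ b E f ⟨
  (E + f) * b                  ≡⟨ hF ⟩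
  b + d + a * suc (b + d)      ≡⟨ expand a b d ⟩
  b + a * suc b + suc a * d    ≡⟨ cong (λ x → x + suc a * d) hE ⟨
  E * (b + d) + suc a * d      ≡⟨ regroup E a b d ⟩
  E * b + (E + suc a) * d      ∎)
  where
  open ≡-Reasoning
  expand : ∀ a b d → b + d + a * suc (b + d) ≡ b + a * suc b + suc a * d
  expand = solve-∀
  regroup : ∀ E a b d → E * (b + d) + suc a * d ≡ E * b + (E + suc a) * d
  regroup = solve-∀

-- Size bounds on the cofactors and on the gap `d = r - q`.

-- Since r - 1 ≥ q, having E ≥ p would make E (r - 1) at least p q, but it is p q - 1.
E≤a : ∀ a b d E → 0 < d → E * (b + d) ≡ b + a * suc b → E ≤ a
E≤a a b d E 0<d hE = ≮⇒≥ λ a<E → <-irrefl (sym hE) (begin-strict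
  b + a * suc b    <⟨ n<1+n _ ⟩
  suc a * suc b    ≡⟨ cong (suc a *_) (+-comm 1 b) ⟩
  suc a * (b + 1)  ≤⟨ *-mono-≤ a<E (+-monoʳ-≤ b 0<d) ⟩
  E * (b + d)      ∎)
  where open ≤-Reasoning

-- If `d` were 1, then r - 1 = q would divide p q - 1.
2≤d : ∀ a b d E → 0 < b → 0 < d → E * (b + d) ≡ b + a * suc b → 2 ≤ d
2≤d _ _ (suc (suc _)) _ _ _ _ = s≤s (s≤s z≤n)
2≤d a b (suc zero) E 0<b 0<d hE = contradiction (begin-strict
  E * (b + 1)    ≡⟨ cong (E *_) (+-comm b 1) ⟩
  E * suc b      ≤⟨ *-monoˡ-≤ (suc b) (E≤a a b 1 E 0<d hE) ⟩
  a * suc b      <⟨ m<n+m (a * suc b) 0<b ⟩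
  b + a * suc b  ∎) (<-irrefl hE)
  where open ≤-Reasoning

f<2d : ∀ a b d E f → a < b → 0 < d →
  E * (b + d) ≡ b + a * suc b →
  (E + f) * b ≡ b + d + a * suc (b + d) →
  f < 2 * d
f<2d a b d E f a<b 0<d hE hF = *-cancelʳ-< b f (2 * d) (begin-strict
  f * b            ≡⟨ f*b≡[E+p]*d a b d E f hE hF ⟩
  (E + suc a) * d  <⟨ *-monoˡ-< d {{>-nonZero 0<d}} (+-mono-≤-< (E≤a a b d E 0<d hE) (s≤s a<b)) ⟩
  (a + suc b) * d  ≤⟨ *-monoˡ-≤ d (≤-reflexive (+-suc a b)) ⟩
  (suc a + b) * d  ≤⟨ *-monoˡ-≤ d (+-monoˡ-≤ b a<b) ⟩
  (b + b) * d      ≡⟨ swap b d ⟩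
  2 * d * b        ∎)
  where
  open ≤-Reasoning
  swap : ∀ b d → (b + b) * d ≡ 2 * d * b
  swap = solve-∀

-- Ensures that `f = F ∸ E` is the true difference.
E≤F : ∀ a b d E F → 0 < b →
  E * (b + d) ≡ b + a * suc b →
  F * b ≡ b + d + a * suc (b + d) →
  E ≤ F
E≤F a b d E F 0<b hE hF = *-cancelʳ-≤ E F b {{>-nonZero 0<b}} (begin
  E * b                    ≤⟨ *-monoʳ-≤ E (m≤m+n b d) ⟩
  E * (b + d)              ≡⟨ hE ⟩
  b + a * suc b            ≤⟨ +-mono-≤ (m≤m+n b d) (*-monoʳ-≤ a (s≤s (m≤m+n b d))) ⟩
  b + d + a * suc (b + d)  ≡⟨ hF ⟨
  F * b                    ∎)
  where open ≤-Reasoning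

a+d≤3d² : ∀ a b d E F G → a < b → 0 < d →
  E * (b + d) ≡ b + a * suc b →
  F * b ≡ b + d + a * suc (b + d) →
  G * a ≡ b + d + b * suc (b + d) →
  a + d ≤ 3 * (d * d)
a+d≤3d² a b d E F G a<b 0<d hE hF hG = begin
  a + d              ≤⟨ +-monoˡ-≤ d (∣⇒≤ {{>-nonZero 0<d[d+f]}} (a∣d*[d+f] a b d E f G hE hE+f hG)) ⟩
  d * (d + f) + d    ≡⟨ absorb d f ⟩
  -- The strictness of `f < 2 * d` pays for the extra summand `d`.
  d * (d + suc f)    ≤⟨ *-monoʳ-≤ d (+-monoʳ-≤ d (f<2d a b d E f a<b 0<d hE hE+f)) ⟩
  d * (d + 2 * d)    ≡⟨ triple d ⟩
  3 * (d * d)        ∎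
  where
  open ≤-Reasoning
  f = F ∸ E
  0<b = ≤-<-trans z≤n a<b
  hE+f : (E + f) * b ≡ b + d + a * suc (b + d)
  hE+f = trans (cong (_* b) (m+[n∸m]≡n (E≤F a b d E F 0<b hE hF))) hF
  0<d[d+f] : 0 < d * (d + f)
  0<d[d+f] = *-mono-≤ 0<d (≤-trans 0<d (m≤m+n d f))
  absorb : ∀ d f → d * (d + f) + d ≡ d * (d + suc f)
  absorb = solve-∀
  triple : ∀ d → d * (d + 2 * d) ≡ 3 * (d * d)
  triple = solve-∀

-- Rational approximation of square roots from above.

-- The bound h < 2 k means (k - 1)² ≤ x, so `k` is the least integer above √ x. In the induction `k`
-- moves on only when h = 1, that is, when x + 1 is itself k².
next-square : ∀ x → ∃₂ λ k h → k * k ≡ x + h × 0 < h × h < 2 * k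
next-square zero = 1 , 1 , refl , s≤s z≤n , s≤s (s≤s z≤n)
next-square (suc x) with next-square x
... | k , suc (suc h) , k²≡ , _ , h< =
      k , suc h , trans k²≡ (+-suc x (suc h)) , s≤s z≤n , <-trans (n<1+n _) h<
... | k , suc zero , k²≡ , _ , _ =
      suc k , suc (2 * k) ,
      trans (square k) (cong (_+ suc (2 * k)) (trans k²≡ (+-comm x 1))) ,
      s≤s z≤n , ≤-reflexive (sym (double k))
  where
  square : ∀ k → suc k * suc k ≡ k * k + suc (2 * k)
  square = solve-∀
  double : ∀ k → 2 * suc k ≡ suc (suc (2 * k))
  double = solve-∀

-- w / (2 k) is the Newton iterate (k + x / k) / 2 of the least integer k > √ x.
newton-step : ∀ x → ∃₂ λ k w → 0 < k ×
  x * (4 * (k * k)) < w * w × w * w ≤ suc x * (4 * (k * k))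
newton-step x with next-square x
... | k , h , k²≡x+h , 0<h , h<2k = k , x + k * k , 0<k , (begin-strict
  x * (4 * (k * k))          <⟨ m<m+n _ (*-mono-≤ 0<h 0<h) ⟩
  x * (4 * (k * k)) + h * h  ≡⟨ w² ⟨
  w * w                      ∎) , (begin
  w * w                                ≡⟨ w² ⟩
  x * (4 * (k * k)) + h * h            ≤⟨ +-monoʳ-≤ (x * (4 * (k * k))) (*-mono-≤ (<⇒≤ h<2k) (<⇒≤ h<2k)) ⟩
  x * (4 * (k * k)) + 2 * k * (2 * k)  ≡⟨ regroup x k ⟩
  suc x * (4 * (k * k))                ∎)
  where
  open ≤-Reasoning
  w = x + k * k
  0<k : 0 < k
  0<k = *-cancelˡ-< 2 0 k (≤-<-trans z≤n h<2k)
  expand : ∀ x h → (x + (x + h)) * (x + (x + h)) ≡ x * (4 * (x + h)) + h * h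
  expand = solve-∀
  -- (x + k²)² - 4 x k² = (k² - x)² = h². Hence (w / 2k)² exceeds x by (h / 2k)², which is positive
  -- and below 1.
  w² : w * w ≡ x * (4 * (k * k)) + h * h
  w² = subst (λ m → (x + m) * (x + m) ≡ x * (4 * m) + h * h) (sym k²≡x+h) (expand x h)
  regroup : ∀ x k → x * (4 * (k * k)) + 2 * k * (2 * k) ≡ suc x * (4 * (k * k))
  regroup = solve-∀

square-cancel-≤ : ∀ {m n} → m * m ≤ n * n → m ≤ n
square-cancel-≤ m²≤n² = ≮⇒≥ λ n<m → <⇒≱ (*-mono-< n<m n<m) m²≤n²

-- By integrality v² > x means v² ≥ x + 1, and (w / 2k)² ≤ x + 1.
root≤ : ∀ {x v k w} → w * w ≤ suc x * (4 * (k * k)) → x < v * v → w ≤ v * (2 * k)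
root≤ {x} {v} {k} {w} upper x<v² = square-cancel-≤ (begin
  w * w                        ≤⟨ upper ⟩
  suc x * (4 * (k * k))        ≤⟨ *-monoˡ-≤ (4 * (k * k)) x<v² ⟩
  v * v * (4 * (k * k))        ≡⟨ regroup v k ⟩
  v * (2 * k) * (v * (2 * k))  ∎)
  where
  open ≤-Reasoning
  regroup : ∀ v k → v * v * (4 * (k * k)) ≡ v * (2 * k) * (v * (2 * k))
  regroup = solve-∀

-- A rational between √ (p / 12) and √ (q r) - q.

-- Put y = w / 2k. In (q + 2 y / c)² the cross term 4 q y / c is at most 4 q v / c, and 4 y² / c² is
-- below 4 q / c because y² < c q. Together they stay below 4 q (v + 1) / c = q d.
[q+w/ck]²<qr : ∀ c q d {r} k v w → q + d ≡ r →
  w ≤ v * (2 * k) → w * w < c * q * (4 * (k * k)) → 4 * suc v ≡ c * d →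
  (q * (c * k) + w) * (q * (c * k) + w) < q * r * (c * k * (c * k))
[q+w/ck]²<qr c q d k v w refl w≤2kv w²< 4[1+v]≡cd = begin-strict
  (q * (c * k) + w) * (q * (c * k) + w)
    ≡⟨ expand c q k w ⟩
  square + (2 * (q * (c * k)) * w + w * w)
    <⟨ +-monoʳ-< square (+-mono-≤-< (*-monoʳ-≤ (2 * (q * (c * k))) w≤2kv) w²<) ⟩
  square + (2 * (q * (c * k)) * (v * (2 * k)) + c * q * (4 * (k * k)))
    ≡⟨ collect c q k v ⟩
  square + q * (c * (k * k)) * (4 * suc v)
    ≡⟨ cong (λ u → square + q * (c * (k * k)) * u) 4[1+v]≡cd ⟩
  square + q * (c * (k * k)) * (c * d)
    ≡⟨ factor c q d k ⟩
  q * (q + d) * (c * k * (c * k)) ∎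
  where
  open ≤-Reasoning
  square = q * q * (c * k * (c * k))
  expand : ∀ c q k w → (q * (c * k) + w) * (q * (c * k) + w)
                     ≡ q * q * (c * k * (c * k)) + (2 * (q * (c * k)) * w + w * w)
  expand = solve-∀
  collect : ∀ c q k v →
    q * q * (c * k * (c * k)) + (2 * (q * (c * k)) * (v * (2 * k)) + c * q * (4 * (k * k)))
    ≡ q * q * (c * k * (c * k)) + q * (c * (k * k)) * (4 * suc v)
  collect = solve-∀
  factor : ∀ c q d k →
    q * q * (c * k * (c * k)) + q * (c * (k * k)) * (c * d) ≡ q * (q + d) * (c * k * (c * k))
  factor = solve-∀

-- With y = w / 2k, the choice e = 4 c turns c (2 y / e)² into y² / e, and y² > e p.
p<c[w/4ck]² : ∀ {c e} p k w .{{_ : NonZero c}} → 4 * c ≡ e → e * p * (4 * (k * k)) < w * w →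
  p * (e * k * (e * k)) < c * (w * w)
p<c[w/4ck]² {c} p k w refl lower =
  subst (_< c * (w * w)) (regroup c p k) (*-monoʳ-< c lower)
  where
  regroup : ∀ c p k → c * (4 * c * p * (4 * (k * k))) ≡ p * (4 * c * k * (4 * c * k))
  regroup = solve-∀

-- The hypothesis on a + d bounds 48 p by 144 d² - 48 d + 48, while v² = 144 d² - 24 d + 1; the
-- difference 24 d - 47 is positive once d ≥ 2.
48p<[12d-1]² : ∀ a d v → 12 * d ≡ suc v → 2 ≤ d → a + d ≤ 3 * (d * d) →
  48 * suc a < v * v
48p<[12d-1]² a d v 12d≡1+v 2≤d a+d≤3d² =
  +-cancelʳ-≤ (48 * d) (suc (48 * suc a)) (v * v) (begin
  suc (48 * suc a) + 48 * d        ≡⟨ distrib 48 a d ⟩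
  49 + 48 * (a + d)                ≤⟨ +-monoʳ-≤ 49 (*-monoʳ-≤ 48 a+d≤3d²) ⟩
  49 + 48 * (3 * (d * d))          ≡⟨ cong (λ x → 49 + x) (*-assoc 48 3 (d * d)) ⟨
  49 + 144 * (d * d)               ≡⟨ cong (λ x → 49 + x) (square-* 12 d) ⟩
  49 + 12 * d * (12 * d)           ≡⟨ cong (λ u → 49 + u * u) 12d≡1+v ⟩
  49 + suc v * suc v               ≡⟨ square-suc 48 v ⟩
  v * v + (2 * suc v + 48)         ≡⟨ cong (λ u → v * v + (2 * u + 48)) 12d≡1+v ⟨
  v * v + (2 * (12 * d) + 48)      ≡⟨ cong (λ x → v * v + (x + 48)) (*-assoc 2 12 d) ⟨
  v * v + (24 * d + 48)            ≤⟨ +-monoʳ-≤ (v * v) (+-monoʳ-≤ (24 * d) (*-monoʳ-≤ 24 2≤d)) ⟩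
  v * v + (24 * d + 24 * d)        ≡⟨ cong (λ x → v * v + x) (*-distribʳ-+ d 24 24) ⟨
  v * v + 48 * d                   ∎)
  where
  open ≤-Reasoning
  distrib : ∀ c a d → suc (c * suc a) + c * d ≡ suc c + c * (a + d)
  distrib = solve-∀
  square-* : ∀ c d → c * c * (d * d) ≡ c * d * (c * d)
  square-* = solve-∀
  square-suc : ∀ c v → suc c + suc v * suc v ≡ v * v + (2 * suc v + c)
  square-suc = solve-∀

1+cm<cn : ∀ {c m n} → 1 < c → m < n → suc (c * m) < c * n
1+cm<cn {c} {m} {n} 1<c m<n = begin-strict
  1 + c * m  <⟨ +-monoˡ-< (c * m) 1<c ⟩
  c + c * m  ≡⟨ *-suc c m ⟨
  c * suc m  ≤⟨ *-monoʳ-≤ c m<n ⟩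
  c * n      ∎
  where open ≤-Reasoning

-- In other words p / c < (w / m)² and (q + w / m)² < q r.  The Newton approximation y
-- of √ (e p) satisfies y² ≤ e p + 1 ≤ v², and w / m = 2 y / e.
-- The case needed is c = 12, e = 48, v = 12 d - 1.
scaled-gap : ∀ c e p q {r} d v .{{_ : NonZero c}} → 0 < e → 4 * c ≡ e → q + d ≡ r →
  suc (e * p) < e * q → e * p < v * v → 4 * suc v ≡ e * d →
  ∃₂ λ m w → 0 < m × 0 < w ×
    p * (m * m) < c * (w * w) ×
    (q * m + w) * (q * m + w) < q * r * (m * m)
scaled-gap c e p q d v 0<e 4c≡e q+d≡r 1+ep<eq ep<v² 4[1+v]≡ed with newton-step (e * p)
... | k , w , 0<k , lower , upper =
  e * k , w , *-mono-≤ 0<e 0<k , 0<w w lower ,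
  p<c[w/4ck]² p k w 4c≡e lower ,
  [q+w/ck]²<qr e q d k v w q+d≡r (root≤ {e * p} {v} {k} upper ep<v²) w²< 4[1+v]≡ed
  where
  0<4k² : 0 < 4 * (k * k)
  0<4k² = *-mono-≤ {1} {4} (s≤s z≤n) (*-mono-≤ 0<k 0<k)
  w²< : w * w < e * q * (4 * (k * k))
  w²< = ≤-<-trans upper (*-monoˡ-< (4 * (k * k)) {{>-nonZero 0<4k²}} 1+ep<eq)
  0<w : ∀ {y} w → y < w * w → 0 < w
  0<w (suc _) _ = s≤s z≤n

rational-gap : ∀ a b d → a < b → 2 ≤ d → a + d ≤ 3 * (d * d) →
  ∃₂ λ m w → 0 < m × 0 < w ×
    suc a * (m * m) < 12 * (w * w) ×
    (suc b * m + w) * (suc b * m + w) < suc b * suc (b + d) * (m * m)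
rational-gap a b d@(suc d′) a<b 2≤d a+d≤3d² =
  scaled-gap 12 48 (suc a) (suc b) d v (s≤s z≤n) refl refl
    (1+cm<cn {48} (s≤s (s≤s z≤n)) (s≤s a<b))
    (48p<[12d-1]² a d v 12d≡1+v 2≤d a+d≤3d²)
    (trans (cong (4 *_) (sym 12d≡1+v)) (sym (*-assoc 4 12 d)))
  where
  -- This is 12 d - 1, the solution of 4 (v + 1) = 48 d, written without subtraction.
  v = 11 + 12 * d′
  12d≡1+v : 12 * d ≡ suc v
  12d≡1+v = *-suc 12 d′

-- Arithmetic of quotients of naturals in ℚ.

toℚᵘ-/ : ∀ i m → toℚᵘ (i / suc m) ℚᵘ.≃ mkℚᵘ i m
toℚᵘ-/ i m = ℚ.toℚᵘ-fromℚᵘ (mkℚᵘ i m)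

/-mono-< : ∀ i m j n .{{_ : NonZero m}} .{{_ : NonZero n}} →
  i * n < j * m → + i / m ℚ.< + j / n
/-mono-< i (suc m) j (suc n) in<jm = ℚ.toℚᵘ-cancel-<
  (ℚᵘ.<-respˡ-≃ (ℚᵘ.≃-sym (toℚᵘ-/ (+ i) m)) (ℚᵘ.<-respʳ-≃ (ℚᵘ.≃-sym (toℚᵘ-/ (+ j) n))
    (ℚᵘ.*<* (subst₂ ℤ._<_ (ℤ.pos-* i (suc n)) (ℤ.pos-* j (suc m)) (ℤ.+<+ in<jm)))))

/-square : ∀ i m .{{_ : NonZero m}} →
  (+ i / m) ℚ.* (+ i / m) ≡ (+ (i * i) / (m * m)) {{m*n≢0 m m}}
/-square i (suc m) = ℚ.toℚᵘ-injective (begin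
  toℚᵘ (x ℚ.* x)                           ≈⟨ ℚ.toℚᵘ-homo-* x x ⟩
  toℚᵘ x ℚᵘ.* toℚᵘ x                       ≈⟨ ℚᵘ.*-cong (toℚᵘ-/ (+ i) m) (toℚᵘ-/ (+ i) m) ⟩
  mkℚᵘ (+ i ℤ.* + i) (m + m * suc m)       ≡⟨ cong (λ j → mkℚᵘ j (m + m * suc m)) (ℤ.pos-* i i) ⟨
  mkℚᵘ (+ (i * i)) (m + m * suc m)         ≈⟨ toℚᵘ-/ (+ (i * i)) (m + m * suc m) ⟨
  toℚᵘ (+ (i * i) / (suc m * suc m))       ∎)
  where
  open import Relation.Binary.Reasoning.Setoid ℚᵘ.≃-setoid
  x = + i / suc m

/-+-integer : ∀ j i m .{{_ : NonZero m}} → + j / 1 ℚ.+ + i / m ≡ + (j * m + i) / m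
/-+-integer j i (suc m) = ℚ.toℚᵘ-injective (begin
  toℚᵘ (+ j / 1 ℚ.+ + i / suc m)           ≈⟨ ℚ.toℚᵘ-homo-+ (+ j / 1) (+ i / suc m) ⟩
  toℚᵘ (+ j / 1) ℚᵘ.+ toℚᵘ (+ i / suc m)   ≈⟨ ℚᵘ.+-cong (toℚᵘ-/ (+ j) 0) (toℚᵘ-/ (+ i) m) ⟩
  mkℚᵘ (+ j ℤ.* + suc m ℤ.+ + i ℤ.* + 1) (m + 0)
    ≡⟨ cong₂ mkℚᵘ (cong₂ ℤ._+_ (sym (ℤ.pos-* j (suc m))) (ℤ.*-identityʳ (+ i))) (+-identityʳ m) ⟩
  mkℚᵘ (+ (j * suc m + i)) m               ≈⟨ toℚᵘ-/ (+ (j * suc m + i)) m ⟨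
  toℚᵘ (+ (j * suc m + i) / suc m)         ∎)
  where open import Relation.Binary.Reasoning.Setoid ℚᵘ.≃-setoid

-- Passage to Dedekind cuts.

-- `w` lies in the upper cut of `√ y` and `x + w` in the lower cut of `√ z`. The latter cut is open,
-- so it contains some `a > x + w`, which leaves room for a witness between `x` and `a - w`.
<ᵣ-√-√ : ∀ {x y z w} → 0ℚ ℚ.< w → y ℚ.< w ℚ.* w → (x ℚ.+ w) ℚ.* (x ℚ.+ w) ℚ.< z →
  fromℚ x <ᵣ √ z -ᵣ √ y
<ᵣ-√-√ {x} {y} {z} {w} 0<w y<w² [x+w]²<z with ℝ.lower-open (√ z) {x ℚ.+ w} (inj₂ [x+w]²<z)
... | a , x+w<a , a∈ with ℚ.<-dense (subst (ℚ._< a ℚ.- w) x+w-w≡x (ℚ.+-monoˡ-< (ℚ.- w) x+w<a))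
  where
  x+w-w≡x : x ℚ.+ w ℚ.- w ≡ x
  x+w-w≡x = trans (ℚ.+-assoc x w (ℚ.- w))
    (trans (cong (λ e → x ℚ.+ e) (ℚ.+-inverseʳ w)) (ℚ.+-identityʳ x))
... | s , x<s , s<a-w = s , x<s , a , w , a∈ , (0<w , y<w²) , s<a-w

q<√-√ : ∀ {n p q r} .{{_ : NonZero p}} → n ≡ p * q * r → 1 < p → p < q → q < r →
  p ∸ 1 ∣ n ∸ 1 → q ∸ 1 ∣ n ∸ 1 → r ∸ 1 ∣ n ∸ 1 → fromℕ q <ᵣ √ (+ n / p) -ᵣ √ (+ p / 12)
q<√-√ {p = suc a} {suc b} {suc c} refl (s≤s 0<a) (s≤s a<b) (s≤s b<c) p-1∣ q-1∣ r-1∣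
  -- Each divisor of n - 1 is moved to the product of the other two factors less 1, after permuting
  -- n to put its own factor last. The cofactors are `E`, `F` and `G`; a product such as
  -- `suc a * suc b ∸ 1` computes to `b + a * suc b`.
  with r-1∣mr-1⇒r-1∣m-1 (suc a * suc b) (suc c) (s≤s z≤n) (s≤s z≤n) r-1∣
     | r-1∣mr-1⇒r-1∣m-1 (suc a * suc c) (suc b) (s≤s z≤n) (s≤s z≤n)
         (subst (λ n → b ∣ n ∸ 1) (pqr≡prq a b c) q-1∣)
     | r-1∣mr-1⇒r-1∣m-1 (suc b * suc c) (suc a) (s≤s z≤n) (s≤s z≤n)
         (subst (λ n → a ∣ n ∸ 1) (pqr≡qrp a b c) p-1∣)
  where
  pqr≡prq : ∀ a b c → suc a * suc b * suc c ≡ suc a * suc c * suc b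
  pqr≡prq = solve-∀
  pqr≡qrp : ∀ a b c → suc a * suc b * suc c ≡ suc b * suc c * suc a
  pqr≡qrp = solve-∀
... | divides E hE | divides F hF | divides G hG with c ∸ b | m+[n∸m]≡n (<⇒≤ b<c)
... | d | refl = conclude (rational-gap a b d a<b (2≤d a b d E 0<b 0<d (sym hE))
                            (a+d≤3d² a b d E F G a<b 0<d (sym hE) (sym hF) (sym hG)))
  where
  0<b : 0 < b
  0<b = <-trans 0<a a<b
  0<d : 0 < d
  0<d = +-cancelˡ-< b 0 d (subst (_< b + d) (sym (+-identityʳ b)) b<c)
  conclude : (∃₂ λ m w → 0 < m × 0 < w ×
      suc a * (m * m) < 12 * (w * w) ×
      (suc b * m + w) * (suc b * m + w) < suc b * suc (b + d) * (m * m)) →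
    fromℕ (suc b) <ᵣ √ (+ (suc a * suc b * suc (b + d)) / suc a) -ᵣ √ (+ suc a / 12)
  conclude (m , w , 0<m , 0<w , above , below) = <ᵣ-√-√ 0<w/m
    (subst (+ suc a / 12 ℚ.<_) (sym (/-square w m))
      (/-mono-< (suc a) 12 (w * w) (m * m) {{_}} {{m*n≢0 m m}}
        (subst (suc a * (m * m) <_) (*-comm 12 (w * w)) above)))
    (subst (λ x → x ℚ.* x ℚ.< _) (sym (/-+-integer (suc b) w m))
      (subst (ℚ._< _) (sym (/-square u m))
        -- Here q r appears as n / p, so `below` is multiplied by p.
        (/-mono-< (u * u) (m * m) (suc a * suc b * suc (b + d)) (suc a) {{m*n≢0 m m}} (subst (u * u * suc a <_)
          (regroup a (suc b) (suc (b + d)) (m * m)) (*-monoˡ-< (suc a) below)))))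
    where
    u = suc b * m + w
    instance
      m≢0 : NonZero m
      m≢0 = >-nonZero 0<m
    0<w/m : 0ℚ ℚ.< + w / m
    0<w/m = /-mono-< 0 1 w m (subst (0 <_) (sym (*-identityʳ w)) 0<w)
    regroup : ∀ a q r m² → q * r * m² * suc a ≡ suc a * q * r * m²
    regroup = solve-∀

theorem4p5 : (k : K₃N) → let open K₃N k in
    fromℕ q <ᵣ √ (+ n / p) -ᵣ √ (+ p / 12)
theorem4p5 k = q<√-√ n≡pqr 1<p p<q q<r p-1∣n-1 q-1∣n-1 r-1∣n-1
  where open K₃N k
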